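{- Let $n \geq 4$ be an integer. Then the connectivity of the graph $Q_n^2$, the square of the hypercube $Q_n$, is maximal, namely it equals its valency: $\kappa(Q_n^2) = n + \binom{n}{2}$.
   Context: All graphs are finite, simple and undirected. The hypercube $Q_n$ is the graph with vertex set $\{0,1\}^n$ in which two $n$-tuples are adjacent if and only if they differ in precisely one coordinate. For a graph $\Gamma=(V,E)$, the square $\Gamma^2$ is the simple graph with vertex set $V$ in which two distinct vertices are adjacent if and only if their distance in $\Gamma$ is at most two. The graph $Q_n^2$ is regular of valency $n+\binom{n}{2}=\binom{n+1}{2}$. A vertex cut of a graph $\Gamma=(V,E)$ is a subset $U$ of $V$ such that the subgraph $\Gamma - U$ induced by $V \setminus U$ is either trivial (a single vertex) or not connected. The connectivity $\kappa(\Gamma)$ of a nontrivial connected graph $\Gamma$ is the minimum cardinality of all vertex cuts of $\Gamma$. One always has $\kappa(\Gamma)\le\delta(\Gamma)$, where $\delta(\Gamma)$ is the minimum degree; "maximal" means that equality holds. -}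

module Defs where

open import Data.Bool using (Bool; true; false)
import Data.Bool.Properties as Bool
open import Data.Empty using (⊥-elim-irr)
open import Data.Irrelevant using ([_])
open import Data.List using (List; []; _∷_; length; cartesianProductWith)
open import Data.List.Membership.Propositional using (_∈_; _∉_)
open import Data.List.Membership.Propositional.Properties
  using (∈-cartesianProductWith⁺)
open import Data.List.Relation.Unary.Any using (here; there; any?)
open import Data.List.Relation.Unary.Unique.Propositional using (Unique)
open import Data.Nat using (ℕ; zero; suc; _≤_)
open import Data.Product using (∃; ∃₂; ∃!; _×_; _,_)
open import Data.Refinement using (Refinement-syntax; _,_; value)
import Data.Refinement.Properties as Refinement
open import Data.Sum using (_⊎_)
open import Data.Vec using (Vec; []; _∷_; lookup)
import Data.Vec.Properties as Vec
open import Function.Bundles using (_⇔_)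
open import Relation.Binary.Definitions using (DecidableEquality)
open import Relation.Binary.PropositionalEquality using (_≡_; _≢_; refl; ≢-sym)
open import Relation.Nullary using (¬_; yes; no)

-- Finiteness of the vertex set is given by an exhaustive list (possibly with
-- repetitions) together with decidable equality.
record Graph : Set₁ where
  field
    V        : Set
    _≟_      : DecidableEquality V
    vertices : List V
    complete : ∀ v → v ∈ vertices
    Adj      : V → V → Set
    symm     : ∀ {u v} → Adj u v → Adj v u
    irrefl   : ∀ {v} → ¬ Adj v v

open Graph

data Walk (Γ : Graph) : V Γ → V Γ → ℕ → Set where
  stop : ∀ {v} → Walk Γ v v zero
  step : ∀ {u v w k} → Adj Γ u v → Walk Γ v w k → Walk Γ u w (suc k)

Connected : Graph → Set
Connected Γ = ∀ u v → ∃ λ k → Walk Γ u v k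

IsDistance : (Γ : Graph) → V Γ → V Γ → ℕ → Set
IsDistance Γ u v d = Walk Γ u v d × (∀ {k} → Walk Γ u v k → d ≤ k)

private
  snoc : ∀ {Γ u v w k} → Walk Γ u v k → Adj Γ v w → Walk Γ u w (suc k)
  snoc stop       e = step e stop
  snoc (step f p) e = step f (snoc p e)

  reverse : ∀ {Γ u v k} → Walk Γ u v k → Walk Γ v u k
  reverse         stop       = stop
  reverse {Γ = Γ} (step e p) = snoc (reverse p) (symm Γ e)

IsDistance-sym : ∀ Γ {u v d} → IsDistance Γ u v d → IsDistance Γ v u d
IsDistance-sym Γ (p , min) = reverse p , λ q → min (reverse q)

square : Graph → Graph
square Γ = record
  { V        = V Γ
  ; _≟_      = _≟_ Γ
  ; vertices = vertices Γ
  ; complete = complete Γ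
  ; Adj      = λ u v → u ≢ v × ∃ λ d → IsDistance Γ u v d × d ≤ 2
  ; symm     = λ (u≢v , d , dist , d≤2) →
                 ≢-sym u≢v , d , IsDistance-sym Γ dist , d≤2
  ; irrefl   = λ (v≢v , _) → v≢v refl
  }

cubeVertices : ∀ n → List (Vec Bool n)
cubeVertices zero    = [] ∷ []
cubeVertices (suc n) =
  cartesianProductWith _∷_ (false ∷ true ∷ []) (cubeVertices n)

cubeVertices-complete : ∀ {n} (v : Vec Bool n) → v ∈ cubeVertices n
cubeVertices-complete []      = here refl
cubeVertices-complete (b ∷ v) =
  ∈-cartesianProductWith⁺ _∷_ (bit b) (cubeVertices-complete v)
  where
  bit : ∀ b → b ∈ false ∷ true ∷ []
  bit false = here refl
  bit true  = there (here refl)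

hypercube : ℕ → Graph
hypercube n = record
  { V        = Vec Bool n
  ; _≟_      = Vec.≡-dec Bool._≟_
  ; vertices = cubeVertices n
  ; complete = cubeVertices-complete
  ; Adj      = λ u v → ∃! _≡_ λ i → lookup u i ≢ lookup v i
  ; symm     = λ (i , ne , unique) → i , ≢-sym ne , λ ne′ → unique (≢-sym ne′)
  ; irrefl   = λ (_ , ne , _) → ne refl
  }

module _ {A : Set} (_≟A_ : DecidableEquality A) (U : List A) where

  outside : List A → List [ x ∈ A ∣ x ∉ U ]
  outside []       = []
  outside (x ∷ xs) with any? (x ≟A_) U
  ... | yes _  = outside xs
  ... | no x∉U = (x , [ x∉U ]) ∷ outside xs

  outside-complete : ∀ xs (x : [ x ∈ A ∣ x ∉ U ]) → value x ∈ xs → x ∈ outside xs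
  outside-complete (y ∷ xs) x@(_ , [ x∉U ]) x∈ with any? (y ≟A_) U | x∈
  ... | yes y∈U | here refl  = ⊥-elim-irr (x∉U y∈U)
  ... | yes _   | there x∈xs = outside-complete xs x x∈xs
  ... | no _    | here refl  = here refl
  ... | no _    | there x∈xs = there (outside-complete xs x x∈xs)

infixl 6 _-_

-- Membership proofs in V (Γ - U) are irrelevant, so vertices of Γ - U are equal
-- as soon as they are equal in Γ.
_-_ : (Γ : Graph) → List (V Γ) → Graph
Γ - U = record
  { V        = [ x ∈ V Γ ∣ x ∉ U ]
  ; _≟_      = Refinement._≟_ (_≟_ Γ)
  ; vertices = outside (_≟_ Γ) U (vertices Γ)
  ; complete = λ x → outside-complete (_≟_ Γ) U (vertices Γ) x (complete Γ (value x))
  ; Adj      = λ x y → Adj Γ (value x) (value y)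
  ; symm     = symm Γ
  ; irrefl   = irrefl Γ
  }

Trivial : Graph → Set
Trivial Γ = ∃ λ (v : V Γ) → ∀ w → w ≡ v

Nontrivial : Graph → Set
Nontrivial Γ = ∃₂ λ (u v : V Γ) → u ≢ v

-- Sets of vertices are duplicate-free lists; their cardinality is the length.
IsVertexCut : (Γ : Graph) → List (V Γ) → Set
IsVertexCut Γ U = Unique U × (Trivial (Γ - U) ⊎ ¬ Connected (Γ - U))

-- κ(Γ) = k, including that Γ lies in the domain of definition of κ.
record IsConnectivity (Γ : Graph) (k : ℕ) : Set where
  field
    nontrivial : Nontrivial Γ
    connected  : Connected Γ
    attained   : ∃ λ U → IsVertexCut Γ U × length U ≡ k
    minimal    : ∀ {U} → IsVertexCut Γ U → k ≤ length U

HasDegree : (Γ : Graph) → V Γ → ℕ → Set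
HasDegree Γ v d =
  ∃ λ N → Unique N × (∀ w → w ∈ N ⇔ Adj Γ v w) × length N ≡ d

IsRegular : Graph → ℕ → Set
IsRegular Γ d = ∀ v → HasDegree Γ v d

IsMinDegree : Graph → ℕ → Set
IsMinDegree Γ δ =
  (∃ λ v → HasDegree Γ v δ) × (∀ {v d} → HasDegree Γ v d → δ ≤ d)

HasMaximalConnectivity : Graph → Set
HasMaximalConnectivity Γ = ∃ λ k → IsConnectivity Γ k × IsMinDegree Γ k

{-# OPTIONS --safe #-}
module Submission where

-- Distances in Qₙ are Hamming distances, and the sphere of radius k has n C k
-- elements, so valency n = n + n C 2.  That fewer than valency n deleted
-- vertices cannot disconnect Qₙ² goes by induction on n,
-- Qₙ² being complete for n ≤ 2.  Split the set U of
-- deleted vertices of Qₙ₊₁ along the first coordinate.  Every vertex has n + 1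
-- neighbours in the opposite half, so if one half contains at most n deleted
-- vertices, that half is connected by induction and every surviving vertex of the
-- other half is adjacent to it.  Otherwise, as valency (n + 1) = valency n + (n + 1),
-- both halves are connected by induction, and it remains to find an edge between
-- them: for n ≥ 4 because 2ⁿ > |U|, so that some matching edge survives; for
-- n = 3 because two distinct closed neighbourhoods in Q₃ cover at least 6 vertices;
-- for n = 2 this case does not occur.

open import Defs
open import Data.Bool using (Bool; true; false; not; _xor_)
import Data.Bool.Properties as Bool
open import Data.Empty using (⊥-elim-irr)
open import Data.Fin using (zero; suc)
import Data.Fin.Properties as Fin
open import Data.Irrelevant using ([_])
open import Data.List using (List; []; _∷_; _++_; length; map; deduplicate)
open import Data.List.Membership.Propositional using (_∈_; _∉_; find; lose)
open import Data.List.Membership.Propositional.Properties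
  using (∈-∃++; ∈-++⁺ˡ; ∈-++⁺ʳ; ∈-++⁻; ∈-map⁺; ∈-map⁻; ∈-deduplicate⁻)
open import Data.List.Properties using (length-++; length-map)
open import Data.List.Relation.Binary.Subset.Propositional using (_⊆_)
open import Data.List.Relation.Unary.All as All using (All)
open import Data.List.Relation.Unary.AllPairs using ([]; _∷_)
open import Data.List.Relation.Unary.Any using (here; there; any?)
open import Data.List.Relation.Unary.Unique.Propositional using (Unique)
open import Data.List.Relation.Unary.Unique.Propositional.Properties
  using (map⁺; ++⁺; cartesianProductWith⁺; Unique[x∷xs]⇒x∉xs)
import Data.List.Relation.Unary.Unique.DecPropositional.Properties as UniqueDec
open import Data.Nat using (ℕ; zero; suc; _+_; _^_; _≤_; _<_; z≤n; s≤s; _≤?_)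
open import Data.Nat.Combinatorics
  using (_C_; nC1≡n; nCn≡1; nCk≡nC[n∸k]; nCk+nC[k+1]≡[n+1]C[k+1])
open import Data.Nat.Properties hiding (_≟_)
open import Data.Product using (∃; ∃₂; _×_; _,_; proj₁; proj₂)
open import Data.Refinement using (_,_; value)
open import Data.Sum using (inj₁; inj₂; [_,_]′)
open import Data.Vec using (Vec; []; _∷_; lookup; replicate)
import Data.Vec.Properties as Vec
open import Function using (_∘_)
open import Function.Bundles using (_⇔_; mk⇔; module Equivalence)
open import Relation.Binary.Construct.Closure.ReflexiveTransitive
  using (Star; ε; _◅_; _◅◅_; gmap; reverse)
open import Relation.Binary.Definitions using (DecidableEquality)
open import Relation.Binary.PropositionalEquality
  using (_≡_; _≢_; refl; sym; trans; cong; cong₂; subst; module ≡-Reasoning)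
open import Relation.Nullary using (¬_; yes; no; contradiction)
open import Relation.Nullary.Decidable
  using (decidable-stable; ¬?; _→-dec_; from-yes)

open Graph using (V; Adj)

-- Counting in duplicate-free lists

module _ {A : Set} where

  -- Induction on `xs`: cut one occurrence of `x` out of `ys`. The tail still embeds in what is
  -- left, because `x` does not occur in it.
  unique-⊆⇒length-≤ : {xs ys : List A} → Unique xs → xs ⊆ ys → length xs ≤ length ys
  unique-⊆⇒length-≤ {[]}     _              _     = z≤n
  unique-⊆⇒length-≤ {x ∷ xs} u@(_ ∷ u′) xs⊆ys with ∈-∃++ (xs⊆ys (here refl))
  ... | as , bs , refl = begin
    suc (length xs)             ≤⟨ s≤s (unique-⊆⇒length-≤ u′ xs⊆as++bs) ⟩
    suc (length (as ++ bs))     ≡⟨ cong suc (length-++ as) ⟩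
    suc (length as + length bs) ≡⟨ +-suc (length as) (length bs) ⟨
    length as + suc (length bs) ≡⟨ length-++ as ⟨
    length (as ++ x ∷ bs)       ∎
    where
    open ≤-Reasoning
    xs⊆as++bs : xs ⊆ as ++ bs
    xs⊆as++bs z∈xs with ∈-++⁻ as (xs⊆ys (there z∈xs))
    ... | inj₁ z∈as         = ∈-++⁺ˡ z∈as
    ... | inj₂ (here refl)  = contradiction z∈xs (Unique[x∷xs]⇒x∉xs u)
    ... | inj₂ (there z∈bs) = ∈-++⁺ʳ as z∈bs

  -- The pigeonhole principle in constructive form; every surviving vertex below is found with it.
  unique-∉ : DecidableEquality A → {xs ys : List A} → Unique xs →
             length ys < length xs → ∃ λ x → x ∈ xs × x ∉ ys
  unique-∉ _≟_ {xs} {ys} u ys<xs with any? (λ x → ¬? (any? (x ≟_) ys)) xs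
  ... | yes x∉ys = find x∉ys
  ... | no none = contradiction (unique-⊆⇒length-≤ u xs⊆ys) (<⇒≱ ys<xs)
    where
    xs⊆ys : xs ⊆ ys
    xs⊆ys x∈xs = decidable-stable (any? (_ ≟_) ys) λ x∉ys → none (lose x∈xs x∉ys)

private
  infix 4 _≟_
  _≟_ : ∀ {n} → DecidableEquality (Vec Bool n)
  _≟_ = Vec.≡-dec Bool._≟_

-- Hamming distance

weight : Bool → ℕ
weight false = 0
weight true  = 1

weight≤1 : ∀ b → weight b ≤ 1
weight≤1 false = z≤n
weight≤1 true  = s≤s z≤n

hamming : ∀ {n} → Vec Bool n → Vec Bool n → ℕ
hamming []      []      = 0
hamming (b ∷ x) (c ∷ y) = weight (b xor c) + hamming x y

hamming-≡ : ∀ {n} b (x y : Vec Bool n) → hamming (b ∷ x) (b ∷ y) ≡ hamming x y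
hamming-≡ false _ _ = refl
hamming-≡ true  _ _ = refl

hamming-flip : ∀ {n} b (x y : Vec Bool n) → hamming (b ∷ x) (not b ∷ y) ≡ suc (hamming x y)
hamming-flip false _ _ = refl
hamming-flip true  _ _ = refl

hamming-refl : ∀ {n} (x : Vec Bool n) → hamming x x ≡ 0
hamming-refl []      = refl
hamming-refl (b ∷ x) = trans (hamming-≡ b x x) (hamming-refl x)

hamming-sym : ∀ {n} (x y : Vec Bool n) → hamming x y ≡ hamming y x
hamming-sym []      []      = refl
hamming-sym (b ∷ x) (c ∷ y) =
  cong₂ _+_ (cong weight (Bool.xor-comm b c)) (hamming-sym x y)

hamming≡0⇒≡ : ∀ {n} (x y : Vec Bool n) → hamming x y ≡ 0 → x ≡ y
hamming≡0⇒≡ []          []          _ = refl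
hamming≡0⇒≡ (false ∷ x) (false ∷ y) h = cong (false ∷_) (hamming≡0⇒≡ x y h)
hamming≡0⇒≡ (true  ∷ x) (true  ∷ y) h = cong (true ∷_) (hamming≡0⇒≡ x y h)

hamming≤n : ∀ {n} (x y : Vec Bool n) → hamming x y ≤ n
hamming≤n []      []      = z≤n
hamming≤n (b ∷ x) (c ∷ y) = +-mono-≤ (weight≤1 (b xor c)) (hamming≤n x y)

hamming-antipodal : ∀ n → hamming (replicate n false) (replicate n true) ≡ n
hamming-antipodal zero    = refl
hamming-antipodal (suc n) = cong suc (hamming-antipodal n)

-- Spheres

sphere : ∀ {n} → ℕ → Vec Bool n → List (Vec Bool n)
sphere zero    []      = [] ∷ []
sphere (suc k) []      = []
sphere zero    (b ∷ x) = map (b ∷_) (sphere zero x)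
sphere (suc k) (b ∷ x) = map (b ∷_) (sphere (suc k) x) ++ map (not b ∷_) (sphere k x)

∈-sphere⁺ : ∀ {n} k (x y : Vec Bool n) → hamming x y ≡ k → y ∈ sphere k x
∈-sphere⁺ zero    []          []          _ = here refl
∈-sphere⁺ zero    (false ∷ x) (false ∷ y) h = ∈-map⁺ _ (∈-sphere⁺ zero x y h)
∈-sphere⁺ zero    (true  ∷ x) (true  ∷ y) h = ∈-map⁺ _ (∈-sphere⁺ zero x y h)
∈-sphere⁺ (suc k) []          []          ()
∈-sphere⁺ (suc k) (false ∷ x) (false ∷ y) h = ∈-++⁺ˡ (∈-map⁺ _ (∈-sphere⁺ (suc k) x y h))
∈-sphere⁺ (suc k) (true  ∷ x) (true  ∷ y) h = ∈-++⁺ˡ (∈-map⁺ _ (∈-sphere⁺ (suc k) x y h))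
∈-sphere⁺ (suc k) (false ∷ x) (true  ∷ y) h =
  ∈-++⁺ʳ (map _ (sphere (suc k) x)) (∈-map⁺ _ (∈-sphere⁺ k x y (suc-injective h)))
∈-sphere⁺ (suc k) (true  ∷ x) (false ∷ y) h =
  ∈-++⁺ʳ (map _ (sphere (suc k) x)) (∈-map⁺ _ (∈-sphere⁺ k x y (suc-injective h)))

∈-sphere⁻ : ∀ {n} k (x y : Vec Bool n) → y ∈ sphere k x → hamming x y ≡ k
∈-sphere⁻ zero    []      []      _  = refl
∈-sphere⁻ zero    (b ∷ x) _       y∈ with ∈-map⁻ (b ∷_) y∈
... | y , y∈′ , refl = trans (hamming-≡ b x y) (∈-sphere⁻ zero x y y∈′)
∈-sphere⁻ (suc k) (b ∷ x) _       y∈ with ∈-++⁻ (map (b ∷_) (sphere (suc k) x)) y∈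
... | inj₁ p with ∈-map⁻ (b ∷_) p
...   | y , y∈′ , refl = trans (hamming-≡ b x y) (∈-sphere⁻ (suc k) x y y∈′)
∈-sphere⁻ (suc k) (b ∷ x) _       y∈ | inj₂ p with ∈-map⁻ (not b ∷_) p
...   | y , y∈′ , refl = trans (hamming-flip b x y) (cong suc (∈-sphere⁻ k x y y∈′))

sphere-unique : ∀ {n} k (x : Vec Bool n) → Unique (sphere k x)
sphere-unique zero    []      = All.[] ∷ []
sphere-unique (suc k) []      = []
sphere-unique zero    (b ∷ x) = map⁺ Vec.∷-injectiveʳ (sphere-unique zero x)
sphere-unique (suc k) (b ∷ x) =
  ++⁺ (map⁺ Vec.∷-injectiveʳ (sphere-unique (suc k) x))
      (map⁺ Vec.∷-injectiveʳ (sphere-unique k x))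
      λ (p , q) → case (∈-map⁻ _ p) (∈-map⁻ _ q)
  where
  case : ∀ {z} → (∃ λ y → y ∈ sphere (suc k) x × z ≡ b ∷ y) →
         ¬ (∃ λ y → y ∈ sphere k x × z ≡ not b ∷ y)
  case (_ , _ , refl) (_ , _ , eq) = Bool.not-¬ refl (Vec.∷-injectiveˡ eq)

nC0≡1 : ∀ n → n C 0 ≡ 1
nC0≡1 n = trans (nCk≡nC[n∸k] {0} {n} z≤n) (nCn≡1 n)

length-sphere : ∀ {n} k (x : Vec Bool n) → length (sphere k x) ≡ n C k
length-sphere zero    []      = refl
length-sphere (suc k) []      = refl
length-sphere {suc n} zero    (b ∷ x) = begin
  length (map (b ∷_) (sphere 0 x)) ≡⟨ length-map (b ∷_) (sphere 0 x) ⟩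
  length (sphere 0 x)              ≡⟨ length-sphere 0 x ⟩
  n C 0                            ≡⟨ nC0≡1 n ⟩
  1                                ≡⟨ nC0≡1 (suc n) ⟨
  suc n C 0                        ∎
  where open ≡-Reasoning
length-sphere {suc n} (suc k) (b ∷ x) = begin
  length (map (b ∷_) far ++ map (not b ∷_) near)          ≡⟨ length-++ (map (b ∷_) far) ⟩
  length (map (b ∷_) far) + length (map (not b ∷_) near)
    ≡⟨ cong₂ _+_ (length-map (b ∷_) far) (length-map (not b ∷_) near) ⟩
  length far + length near
    ≡⟨ cong₂ _+_ (length-sphere (suc k) x) (length-sphere k x) ⟩
  n C suc k + n C k                                       ≡⟨ +-comm (n C suc k) (n C k) ⟩
  n C k + n C suc k                                       ≡⟨ nCk+nC[k+1]≡[n+1]C[k+1] n k ⟩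
  suc n C suc k                                           ∎
  where
  open ≡-Reasoning
  far  = sphere (suc k) x
  near = sphere k x

-- Two radii cover both uses: `k = 0` gives the closed neighbourhood in Qₙ, `k = 1` the open
-- neighbourhood in Qₙ².
spheres : ∀ {n} → ℕ → Vec Bool n → List (Vec Bool n)
spheres k x = sphere k x ++ sphere (suc k) x

∈-spheres⁺ : ∀ {n k} (x y : Vec Bool n) → k ≤ hamming x y → hamming x y ≤ suc k →
             y ∈ spheres k x
∈-spheres⁺ {k = k} x y k≤h h≤1+k with m≤n⇒m<n∨m≡n h≤1+k
... | inj₁ (s≤s h≤k) = ∈-++⁺ˡ (∈-sphere⁺ k x y (≤-antisym h≤k k≤h))
... | inj₂ h≡1+k     = ∈-++⁺ʳ (sphere k x) (∈-sphere⁺ (suc k) x y h≡1+k)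

∈-spheres⁻ : ∀ {n k} (x : Vec Bool n) {y} → y ∈ spheres k x →
             k ≤ hamming x y × hamming x y ≤ suc k
∈-spheres⁻ {k = k} x {y} y∈ with ∈-++⁻ (sphere k x) y∈
... | inj₁ p with refl ← ∈-sphere⁻ k x y p = ≤-refl , n≤1+n k
... | inj₂ p rewrite ∈-sphere⁻ (suc k) x y p = n≤1+n k , ≤-refl

spheres-unique : ∀ {n} k (x : Vec Bool n) → Unique (spheres k x)
spheres-unique k x = ++⁺ (sphere-unique k x) (sphere-unique (suc k) x)
  λ {y} (p , q) → 1+n≢n (trans (sym (∈-sphere⁻ (suc k) x y q)) (∈-sphere⁻ k x y p))

length-spheres : ∀ {n} k (x : Vec Bool n) → length (spheres k x) ≡ n C k + n C suc k
length-spheres k x = trans (length-++ (sphere k x))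
                           (cong₂ _+_ (length-sphere k x) (length-sphere (suc k) x))

-- In Qₙ₊₁², the neighbours of `b ∷ x` in the opposite half are the `not b ∷ y` with `y` in this
-- ball.
ball : ∀ {n} → Vec Bool n → List (Vec Bool n)
ball = spheres 0

length-ball : ∀ {n} (x : Vec Bool n) → length (ball x) ≡ suc n
length-ball {n} x = trans (length-spheres 0 x) (cong₂ _+_ (nC0≡1 n) (nC1≡n n))

-- Growth of the valency

valency : ℕ → ℕ
valency n = n + n C 2

length-neighbours : ∀ {n} (x : Vec Bool n) → length (spheres 1 x) ≡ valency n
length-neighbours {n} x = trans (length-spheres 1 x) (cong (_+ n C 2) (nC1≡n n))

-- Pascal's rule. It balances the induction: when one half loses at least `suc n` vertices, fewer
-- than `valency n` are lost in the other.
valency-suc : ∀ n → valency (suc n) ≡ valency n + suc n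
valency-suc n = begin
  suc n + suc n C 2       ≡⟨ cong (suc n +_) (nCk+nC[k+1]≡[n+1]C[k+1] n 1) ⟨
  suc n + (n C 1 + n C 2) ≡⟨ cong (λ m → suc n + (m + n C 2)) (nC1≡n n) ⟩
  suc n + (n + n C 2)     ≡⟨ +-comm (suc n) (valency n) ⟩
  valency n + suc n       ∎
  where open ≡-Reasoning

n<valency : ∀ {n} → 2 ≤ n → n < valency n
n<valency {suc n} (s≤s 1≤n) = begin-strict
  suc n             <⟨ +-monoˡ-≤ (suc n) (≤-trans 1≤n (m≤m+n n (n C 2))) ⟩
  valency n + suc n ≡⟨ valency-suc n ⟨
  valency (suc n)   ∎
  where open ≤-Reasoning

-- Makes room for a matching edge that avoids all deleted vertices. The bound fails at 3, where it
-- would read 10 ≤ 8, so that dimension gets its own argument.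
valency-suc≤2^n : ∀ {n} → 4 ≤ n → valency (suc n) ≤ 2 ^ n
valency-suc≤2^n {suc n} (s≤s 3≤n) with m≤n⇒m<n∨m≡n 3≤n
-- Here `valency 5` is 15 and the power is 16.
... | inj₂ refl = n≤1+n 15
... | inj₁ 4≤n  = begin
  -- The increment `2 + n` is at most `valency (suc n)` by `n<valency`, so the induction hypothesis
  -- bounds both summands.
  valency (2 + n)             ≡⟨ valency-suc (suc n) ⟩
  valency (suc n) + (2 + n)   ≤⟨ +-mono-≤ ih (≤-trans (n<valency (s≤s (≤-trans (s≤s z≤n) 3≤n))) ih) ⟩
  2 ^ n + 2 ^ n               ≡⟨ cong (2 ^ n +_) (+-identityʳ (2 ^ n)) ⟨
  2 ^ suc n                   ∎
  where
  open ≤-Reasoning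
  ih = valency-suc≤2^n 4≤n

-- Connectedness after deleting few vertices

-- Loops are allowed, which spares a case distinction on `x ≡ y` until walks are built. Excluding
-- both endpoints from `U` keeps the relation symmetric.
Link : ∀ {n} → List (Vec Bool n) → Vec Bool n → Vec Bool n → Set
Link U x y = hamming x y ≤ 2 × x ∉ U × y ∉ U

Joined : ∀ {n} → List (Vec Bool n) → Vec Bool n → Vec Bool n → Set
Joined U = Star (Link U)

Joined-sym : ∀ {n} {U : List (Vec Bool n)} {x y} → Joined U x y → Joined U y x
Joined-sym = reverse λ {x} {y} (h , x∉U , y∉U) → subst (_≤ 2) (hamming-sym x y) h , y∉U , x∉U

-- Splitting along the first coordinate

slice : ∀ {n} → Bool → List (Vec Bool (suc n)) → List (Vec Bool n)
slice b     []                = []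
slice false ((false ∷ x) ∷ U) = x ∷ slice false U
slice false ((true  ∷ x) ∷ U) = slice false U
slice true  ((false ∷ x) ∷ U) = slice true U
slice true  ((true  ∷ x) ∷ U) = x ∷ slice true U

∈-slice⁺ : ∀ {n} b {x : Vec Bool n} {U} → b ∷ x ∈ U → x ∈ slice b U
∈-slice⁺ false                       (here refl) = here refl
∈-slice⁺ true                        (here refl) = here refl
∈-slice⁺ false {U = (false ∷ _) ∷ _} (there p)   = there (∈-slice⁺ false p)
∈-slice⁺ false {U = (true  ∷ _) ∷ _} (there p)   = ∈-slice⁺ false p
∈-slice⁺ true  {U = (false ∷ _) ∷ _} (there p)   = ∈-slice⁺ true p
∈-slice⁺ true  {U = (true  ∷ _) ∷ _} (there p)   = there (∈-slice⁺ true p)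

∈-slice⁻ : ∀ {n} b {x : Vec Bool n} {U} → x ∈ slice b U → b ∷ x ∈ U
∈-slice⁻ false {U = (false ∷ _) ∷ _} (here refl) = here refl
∈-slice⁻ false {U = (false ∷ _) ∷ _} (there p)   = there (∈-slice⁻ false p)
∈-slice⁻ false {U = (true  ∷ _) ∷ _} p           = there (∈-slice⁻ false p)
∈-slice⁻ true  {U = (false ∷ _) ∷ _} p           = there (∈-slice⁻ true p)
∈-slice⁻ true  {U = (true  ∷ _) ∷ _} (here refl) = here refl
∈-slice⁻ true  {U = (true  ∷ _) ∷ _} (there p)   = there (∈-slice⁻ true p)

length-slices : ∀ {n} (U : List (Vec Bool (suc n))) →
                length (slice false U) + length (slice true U) ≡ length U
length-slices []                = refl
length-slices ((false ∷ x) ∷ U) = cong suc (length-slices U)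
length-slices ((true  ∷ x) ∷ U) = trans (+-suc _ _) (cong suc (length-slices U))

cubeVertices-unique : ∀ n → Unique (cubeVertices n)
cubeVertices-unique zero    = All.[] ∷ []
cubeVertices-unique (suc n) =
  cartesianProductWith⁺ _∷_ Vec.∷-injective bits-unique (cubeVertices-unique n)
  where
  bits-unique : Unique (false ∷ true ∷ [])
  bits-unique = ((λ ()) All.∷ All.[]) ∷ All.[] ∷ []

length-cubeVertices : ∀ n → length (cubeVertices n) ≡ 2 ^ n
length-cubeVertices zero    = refl
length-cubeVertices (suc n) = begin
  length (map (false ∷_) vs ++ (map (true ∷_) vs ++ []))
    ≡⟨ length-++ (map (false ∷_) vs) ⟩
  length (map (false ∷_) vs) + length (map (true ∷_) vs ++ [])
    ≡⟨ cong (length (map (false ∷_) vs) +_) (length-++ (map (true ∷_) vs)) ⟩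
  length (map (false ∷_) vs) + (length (map (true ∷_) vs) + 0)
    ≡⟨ cong₂ (λ l m → l + (m + 0)) (length-map (false ∷_) vs) (length-map (true ∷_) vs) ⟩
  length vs + (length vs + 0)
    ≡⟨ cong (λ l → l + (l + 0)) (length-cubeVertices n) ⟩
  2 ^ suc n ∎
  where
  open ≡-Reasoning
  vs = cubeVertices n

vertex-∉ : ∀ {n} (U : List (Vec Bool n)) → length U < 2 ^ n → ∃ λ x → x ∉ U
vertex-∉ {n} U U<2^n =
  let x , _ , x∉U = unique-∉ _≟_ (cubeVertices-unique n)
                      (subst (length U <_) (sym (length-cubeVertices n)) U<2^n)
  in x , x∉U

-- Each ball has 4 elements, and two distinct ones share at most 2. Verified by evaluation on all 64
-- pairs; `deduplicate` makes the length count the union.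
two-balls : (x y : Vec Bool 3) → x ≢ y → 6 ≤ length (deduplicate _≟_ (ball x ++ ball y))
two-balls x y =
  All.lookup (All.lookup (from-yes large?) (cubeVertices-complete x)) (cubeVertices-complete y)
  where
  large? = All.all? (λ x → All.all? (λ y →
             ¬? (x ≟ y) →-dec (6 ≤? length (deduplicate _≟_ (ball x ++ ball y))))
             (cubeVertices 3)) (cubeVertices 3)

-- Distance at most 1 in Qₙ, as flipping the first coordinate uses up the other unit of the allowed
-- 2.
Bridge : ∀ {n} → List (Vec Bool n) → List (Vec Bool n) → Set
Bridge U W = ∃₂ λ x y → hamming x y ≤ 1 × x ∉ U × y ∉ W

-- With 8 vertices and at most 5 deleted, two distinct `x` and `y` survive in the first half. Their
-- balls cover at least 6 vertices, too many for `W` to contain.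
bridge₃ : (U W : List (Vec Bool 3)) → length U ≤ 5 → length W ≤ 5 → Bridge U W
bridge₃ U W U≤5 W≤5
  with x , x∉U   ← vertex-∉ U (s≤s (≤-trans U≤5 (m≤m+n 5 2)))
  with y , y∉x∷U ← vertex-∉ (x ∷ U) (s≤s (≤-trans (s≤s U≤5) (n≤1+n 6)))
  with z , z∈ , z∉W ← unique-∉ _≟_ (UniqueDec.deduplicate-! _≟_ (ball x ++ ball y))
                        (≤-trans (s≤s W≤5) (two-balls x y λ x≡y → y∉x∷U (here (sym x≡y))))
  with ∈-++⁻ (ball x) (∈-deduplicate⁻ _≟_ (ball x ++ ball y) z∈)
... | inj₁ z∈x = x , z , proj₂ (∈-spheres⁻ x z∈x) , x∉U , z∉W
... | inj₂ z∈y = y , z , proj₂ (∈-spheres⁻ y z∈y) , y∉x∷U ∘ there , z∉W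

bridge : ∀ n → 2 ≤ n → (U W : List (Vec Bool n)) → n < length U → n < length W →
         length U + length W < valency (suc n) → Bridge U W
bridge 1 (s≤s ())
-- At least 3 + 3 deleted vertices would be needed, yet the total is below `valency 3`, which is 6.
bridge 2 _ U W n<U n<W U+W< = contradiction (+-mono-≤ n<U n<W) (<⇒≱ U+W<)
bridge 3 _ U W n<U n<W U+W< = bridge₃ U W
  -- The total is at most 9, as `valency 4` is 10, and each half has at least 4; so neither exceeds
  -- 5.
  (+-cancelʳ-≤ 4 (length U) 5 (≤-trans (+-monoʳ-≤ (length U) n<W) (≤-pred U+W<)))
  (+-cancelˡ-≤ 4 (length W) 5 (≤-trans (+-monoˡ-≤ (length W) n<U) (≤-pred U+W<)))
bridge n@(suc (suc (suc (suc _)))) _ U W _ _ U+W< =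
  -- A vertex `z` deleted in neither half gives a matching edge.
  let z , z∉ = vertex-∉ (U ++ W)
        (<-≤-trans (subst (_< valency (suc n)) (sym (length-++ U)) U+W<)
                   (valency-suc≤2^n {n} (s≤s (s≤s (s≤s (s≤s z≤n))))))
  in z , z , ≤-trans (≤-reflexive (hamming-refl z)) z≤n , z∉ ∘ ∈-++⁺ˡ , z∉ ∘ ∈-++⁺ʳ U

module _ {n} (U : List (Vec Bool (suc n))) where

  SliceJoined : Bool → Set
  SliceJoined b = ∀ {x y} → x ∉ slice b U → y ∉ slice b U → Joined (slice b U) x y

  Joined-slice : ∀ b {x y} → Joined (slice b U) x y → Joined U (b ∷ x) (b ∷ y)
  Joined-slice b = gmap (b ∷_) λ {x} {y} (h , x∉ , y∉) →
    subst (_≤ 2) (sym (hamming-≡ b x y)) h , x∉ ∘ ∈-slice⁺ b , y∉ ∘ ∈-slice⁺ b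

  Joined-across : ∀ b {x y} → hamming x y ≤ 1 → b ∷ x ∉ U → not b ∷ y ∉ U →
                  Joined U (b ∷ x) (not b ∷ y)
  Joined-across b {x} {y} h x∉U y∉U =
    (subst (_≤ 2) (sym (hamming-flip b x y)) (s≤s h) , x∉U , y∉U) ◅ ε

  -- A survivor of the other half has `suc n` neighbours in this one, of which at most `n` are
  -- deleted. So every survivor reaches this half, where `joined` takes over.
  joined-via-slice : ∀ b → length (slice b U) ≤ n → SliceJoined b →
                     ∀ {x y} → x ∉ U → y ∉ U → Joined U x y
  joined-via-slice b small joined x∉U y∉U =
    let _ , x′∉ , x~ = to-slice x∉U
        _ , y′∉ , y~ = to-slice y∉U
    in x~ ◅◅ Joined-slice b (joined x′∉ y′∉) ◅◅ Joined-sym y~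
    where
    across : ∀ {x} → not b ∷ x ∉ U → ∃ λ y → y ∉ slice b U × Joined U (not b ∷ x) (b ∷ y)
    across {x} x∉U =
      let y , y∈ , y∉ = unique-∉ _≟_ (spheres-unique 0 x)
                          (subst (length (slice b U) <_) (sym (length-ball x)) (s≤s small))
          h = subst (_≤ 1) (hamming-sym x y) (proj₂ (∈-spheres⁻ x y∈))
      in y , y∉ , Joined-sym (Joined-across b h (y∉ ∘ ∈-slice⁺ b) x∉U)

    to-slice : ∀ {x} → x ∉ U → ∃ λ y → y ∉ slice b U × Joined U x (b ∷ y)
    to-slice {c ∷ x} x∉U with c Bool.≟ b
    ... | yes refl = x , x∉U ∘ ∈-slice⁻ b , ε
    ... | no c≢b with refl ← Bool.¬-not c≢b = across x∉U

  -- All survivors are joined to the single vertex `false ∷ p`, those of the other half by way of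
  -- `true ∷ q`.
  joined-via-bridge : Bridge (slice false U) (slice true U) →
                      (∀ b → SliceJoined b) → ∀ {x y} → x ∉ U → y ∉ U → Joined U x y
  joined-via-bridge (p , q , h , p∉ , q∉) joined x∉U y∉U =
    to-p _ x∉U ◅◅ Joined-sym (to-p _ y∉U)
    where
    to-p : ∀ x → x ∉ U → Joined U x (false ∷ p)
    to-p (false ∷ x) x∉U = Joined-slice false (joined false (x∉U ∘ ∈-slice⁻ false) p∉)
    to-p (true  ∷ x) x∉U = Joined-slice true (joined true (x∉U ∘ ∈-slice⁻ true) q∉)
      ◅◅ Joined-sym (Joined-across false h (p∉ ∘ ∈-slice⁺ false) (q∉ ∘ ∈-slice⁺ true))

few-removed⇒joined : ∀ n (U : List (Vec Bool n)) → length U < valency n →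
                     ∀ {x y} → x ∉ U → y ∉ U → Joined U x y
few-removed⇒joined n U U< {x} {y} x∉U y∉U with n ≤? 2
... | yes n≤2 = (≤-trans (hamming≤n x y) n≤2 , x∉U , y∉U) ◅ ε
few-removed⇒joined zero    U U< x∉U y∉U | no n≰2 = contradiction z≤n n≰2
few-removed⇒joined (suc n) U U< x∉U y∉U | no n≰2
  with length (slice false U) ≤? n | length (slice true U) ≤? n
... | yes small | _         = joined-via-slice U false small
  (few-removed⇒joined n _ (≤-<-trans small (n<valency (≤-pred (≰⇒> n≰2))))) x∉U y∉U
... | no _      | yes small = joined-via-slice U true small
  (few-removed⇒joined n _ (≤-<-trans small (n<valency (≤-pred (≰⇒> n≰2))))) x∉U y∉U
... | no big₀   | no big₁   = joined-via-bridge U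
  (bridge n (≤-pred (≰⇒> n≰2)) _ _ (≰⇒> big₀) (≰⇒> big₁) slices<)
  -- The opposite slice accounts for at least `suc n` deletions; cancelling these from the total
  -- leaves fewer than `valency n` here.
  (λ { false → few-removed⇒joined n _ (+-cancelʳ-< (suc n) _ _
         (≤-<-trans (+-monoʳ-≤ (length (slice false U)) (≰⇒> big₁)) slices<′))
     ; true  → few-removed⇒joined n _ (+-cancelˡ-< (suc n) _ _
         (≤-<-trans (+-monoˡ-≤ (length (slice true U)) (≰⇒> big₀))
                    (subst (length (slice false U) + length (slice true U) <_)
                           (+-comm (valency n) (suc n)) slices<′))) })
  x∉U y∉U
  where
  slices< : length (slice false U) + length (slice true U) < valency (suc n)
  slices< = subst (_< valency (suc n)) (sym (length-slices U)) U<
  slices<′ : length (slice false U) + length (slice true U) < valency n + suc n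
  slices<′ = subst (length (slice false U) + length (slice true U) <_) (valency-suc n) slices<

-- Adjacency in the square of the hypercube

lookup-injective : ∀ {A : Set} {n} {x y : Vec A n} → (∀ i → lookup x i ≡ lookup y i) → x ≡ y
lookup-injective {x = x} {y} eq =
  trans (sym (Vec.tabulate∘lookup x)) (trans (Vec.tabulate-cong eq) (Vec.tabulate∘lookup y))

-- An edge flips one coordinate, which moves the distance to `z` by at most one. Iterated along a
-- walk, this shows that no walk is shorter than the Hamming distance.
adj⇒hamming-≤ : ∀ {n} (x y z : Vec Bool n) → Adj (hypercube n) x y →
                hamming x z ≤ suc (hamming y z)
adj⇒hamming-≤ (b ∷ x) (c ∷ y) (d ∷ z) (zero , _ , unique)
  -- The differing coordinate is the first, so by its uniqueness the tails coincide.
  with refl ← lookup-injective {x = x} {y} (λ i → decidable-stable (lookup x i Bool.≟ lookup y i)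
                (λ ne → Fin.0≢1+n (unique {suc i} ne)))
  = +-mono-≤ (weight≤1 (b xor d)) (m≤n+m (hamming x z) (weight (c xor d)))
adj⇒hamming-≤ (b ∷ x) (c ∷ y) (d ∷ z) (suc i , ne , unique)
  -- The differing coordinate lies in the tail, so the heads coincide.
  with refl ← decidable-stable (b Bool.≟ c) (λ b≢c → Fin.0≢1+n (sym (unique {zero} b≢c)))
  = ≤-trans (+-monoʳ-≤ (weight (b xor d))
              (adj⇒hamming-≤ x y z (i , ne , λ ne′ → Fin.suc-injective (unique {suc _} ne′))))
            (≤-reflexive (+-suc (weight (b xor d)) (hamming y z)))

hamming≤walk : ∀ {n} {x y : Vec Bool n} {k} → Walk (hypercube n) x y k → hamming x y ≤ k
hamming≤walk {x = x} stop = ≤-reflexive (hamming-refl x)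
hamming≤walk {x = x} {y} (step {v = z} e p) =
  ≤-trans (adj⇒hamming-≤ x z y e) (s≤s (hamming≤walk p))

walk-∷ : ∀ {n} b {x y : Vec Bool n} {k} → Walk (hypercube n) x y k →
         Walk (hypercube (suc n)) (b ∷ x) (b ∷ y) k
walk-∷ b stop       = stop
walk-∷ b (step (i , ne , unique) p) =
  step (suc i , ne , λ { {zero} b≢b → contradiction refl b≢b
                       ; {suc j} ne′ → cong suc (unique ne′) })
       (walk-∷ b p)

adj-flip : ∀ {n} {b c} {x : Vec Bool n} → b ≢ c → Adj (hypercube (suc n)) (b ∷ x) (c ∷ x)
adj-flip b≢c = zero , b≢c , λ { {zero} _ → refl ; {suc j} ne → contradiction refl ne }

-- Flip the differing coordinates from left to right. With `hamming≤walk` this identifies graph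
-- distance with Hamming distance.
geodesic : ∀ {n} (x y : Vec Bool n) → Walk (hypercube n) x y (hamming x y)
geodesic []          []          = stop
geodesic (false ∷ x) (false ∷ y) = walk-∷ false (geodesic x y)
geodesic (true  ∷ x) (true  ∷ y) = walk-∷ true (geodesic x y)
geodesic (false ∷ x) (true  ∷ y) = step (adj-flip λ ()) (walk-∷ true (geodesic x y))
geodesic (true  ∷ x) (false ∷ y) = step (adj-flip λ ()) (walk-∷ false (geodesic x y))

squareAdj⁺ : ∀ {n} {x y : Vec Bool n} → x ≢ y → hamming x y ≤ 2 →
             Adj (square (hypercube n)) x y
squareAdj⁺ {x = x} {y} x≢y h≤2 = x≢y , hamming x y , (geodesic x y , hamming≤walk) , h≤2

squareAdj⁻ : ∀ {n} {x y : Vec Bool n} → Adj (square (hypercube n)) x y →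
             x ≢ y × hamming x y ≤ 2
squareAdj⁻ (x≢y , _ , (p , _) , d≤2) = x≢y , ≤-trans (hamming≤walk p) d≤2

∈neighbours⇔adj : ∀ {n} (x y : Vec Bool n) → y ∈ spheres 1 x ⇔ Adj (square (hypercube n)) x y
∈neighbours⇔adj {n} x y = mk⇔ to from
  where
  to : y ∈ spheres 1 x → Adj (square (hypercube n)) x y
  to y∈ = squareAdj⁺ (λ { refl → <⇒≢ (proj₁ (∈-spheres⁻ x y∈)) (sym (hamming-refl x)) })
                     (proj₂ (∈-spheres⁻ x y∈))
  from : Adj (square (hypercube n)) x y → y ∈ spheres 1 x
  from adj = let x≢y , h≤2 = squareAdj⁻ adj
             in ∈-spheres⁺ x y (n≢0⇒n>0 (x≢y ∘ hamming≡0⇒≡ x y)) h≤2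

square-regular : ∀ n → IsRegular (square (hypercube n)) (valency n)
square-regular n x =
  spheres 1 x , spheres-unique 1 x , ∈neighbours⇔adj x , length-neighbours x

-- Both lists enumerate the neighbours of `v`, so the first, free of duplicates, is contained in the
-- second.
HasDegree-unique-≤ : ∀ {Γ v d e} → HasDegree Γ v d → HasDegree Γ v e → d ≤ e
HasDegree-unique-≤ (_ , u , N⇔ , refl) (_ , _ , M⇔ , refl) =
  unique-⊆⇒length-≤ u λ {w} → Equivalence.from (M⇔ w) ∘ Equivalence.to (N⇔ w)

regular⇒minDegree : ∀ {Γ d} → V Γ → IsRegular Γ d → IsMinDegree Γ d
regular⇒minDegree {Γ} v reg =
  (v , reg v) , λ {w} deg → HasDegree-unique-≤ {Γ} (reg w) deg

-- Connectivity

module _ (n : ℕ) where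

  private Γ = square (hypercube n)

  -- The proofs of non-membership are irrelevant arguments because the vertices of `Γ - U` store
  -- them irrelevantly.
  joined⇒walk : ∀ {U x y} .(x∉U : x ∉ U) .(y∉U : y ∉ U) → Joined U x y →
                ∃ λ k → Walk (Γ - U) (x , [ x∉U ]) (y , [ y∉U ]) k
  joined⇒walk x∉U y∉U ε = 0 , stop
  joined⇒walk {x = x} x∉U y∉U (_◅_ {j = z} (h , _ , z∉U) zy)
    with x ≟ z | joined⇒walk z∉U y∉U zy
  -- A loop is dropped, since a walk in a simple graph cannot use it.
  ... | yes refl | walk     = walk
  ... | no x≢z   | k , walk = suc k , step (squareAdj⁺ x≢z h) walk

  few-removed⇒connected : ∀ U → length U < valency n → Connected (Γ - U)
  few-removed⇒connected U U< (x , [ x∉U ]) (y , [ y∉U ]) =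
    -- As negations end in the empty type, `⊥-elim-irr` recovers usable proofs from the irrelevant
    -- ones.
    joined⇒walk x∉U y∉U (few-removed⇒joined n U U< (λ p → ⊥-elim-irr (x∉U p))
                                                   (λ p → ⊥-elim-irr (y∉U p)))

walk-value : ∀ {Γ U u v k} → Walk (Γ - U) u v k → Walk Γ (value u) (value v) k
walk-value stop       = stop
walk-value (step e p) = step e (walk-value p)

-- Once its neighbours are deleted, `x` is isolated, while `y` is too far away to be among them and
-- survives.
neighbours-isolate : ∀ {n} (x y : Vec Bool n) → 2 < hamming x y →
                     ¬ Connected (square (hypercube n) - spheres 1 x)
neighbours-isolate {n} x y 2<h connected =
  isolated (connected (x , [ x∉ ]) (y , [ y∉ ]))
  where
  x∉ : x ∉ spheres 1 x
  x∉ x∈ = <⇒≢ (proj₁ (∈-spheres⁻ x x∈)) (sym (hamming-refl x))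
  y∉ : y ∉ spheres 1 x
  y∉ y∈ = <⇒≱ 2<h (proj₂ (∈-spheres⁻ x y∈))
  isolated : ¬ ∃ λ k → Walk (square (hypercube n) - spheres 1 x) (x , [ x∉ ]) (y , [ y∉ ]) k
  isolated (_ , stop) = n≮0 (subst (2 <_) (hamming-refl x) 2<h)
  -- The first step would end in a surviving neighbour of `x`.
  isolated (_ , step {v = z , [ z∉ ]} e _) =
    ⊥-elim-irr (z∉ (Equivalence.from (∈neighbours⇔adj x z) e))

square-connectivity : ∀ {n} → 4 ≤ n → IsConnectivity (square (hypercube n)) (valency n)
square-connectivity {n} 4≤n = record
  { nontrivial = o , i , λ o≡i →
      n≮0 (subst (2 <_) (trans (cong (hamming o) (sym o≡i)) (hamming-refl o)) 2<h)
  -- Connectedness of the whole graph is the case of deleting nothing.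
  ; connected  = λ x y →
      let k , p = few-removed⇒connected n [] 0<valency (x , [ (λ ()) ]) (y , [ (λ ()) ])
      in k , walk-value p
  ; attained   = spheres 1 o , (spheres-unique 1 o , inj₂ (neighbours-isolate o i 2<h))
               , length-neighbours o
  ; minimal    = λ {U} (_ , cut) → ≮⇒≥ λ U< →
      [ nontrivial U U< , (λ disconnected → disconnected (few-removed⇒connected n U U<)) ]′ cut
  }
  where
  -- Antipodal vertices have distance `n`, hence more than 2.
  o = replicate n false
  i = replicate n true

  2<h : 2 < hamming o i
  2<h = subst (2 <_) (sym (hamming-antipodal n)) (≤-trans (n≤1+n 3) 4≤n)

  0<valency : 0 < valency n
  0<valency = ≤-trans (≤-trans (s≤s z≤n) 4≤n) (m≤m+n n (n C 2))

  valency<2^n : valency n < 2 ^ n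
  valency<2^n = begin-strict
    valency n         <⟨ m<m+n (valency n) (s≤s z≤n) ⟩
    valency n + suc n ≡⟨ valency-suc n ⟨
    valency (suc n)   ≤⟨ valency-suc≤2^n 4≤n ⟩
    2 ^ n             ∎
    where open ≤-Reasoning

  nontrivial : ∀ U → length U < valency n → ¬ Trivial (square (hypercube n) - U)
  nontrivial U U< ((x , _) , only) =
    -- Adding `x` to `U` still leaves at most `valency n` vertices, fewer than 2ⁿ, so a second
    -- survivor exists.
    let y , y∉ = vertex-∉ (x ∷ U) (≤-<-trans U< valency<2^n)
    in y∉ (here (cong value (only (y , [ y∉ ∘ there ]))))

corollary3p4 : (n : ℕ) → 4 ≤ n →
    HasMaximalConnectivity (square (hypercube n))
    × IsRegular (square (hypercube n)) (n + (n C 2))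
    × IsConnectivity (square (hypercube n)) (n + (n C 2))
corollary3p4 n 4≤n =
  (valency n , connectivity ,
    regular⇒minDegree {square (hypercube n)} (replicate n false) (square-regular n))
  , square-regular n , connectivity
  where connectivity = square-connectivity 4≤n
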